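{- Let $\Psi:\mathbb{Q}[x]\to\mathbb{Q}$ be the linear form with $\Psi(x^n)=B_n$, where $\frac{t}{e^t-1}=\sum_{n\ge0}B_n\frac{t^n}{n!}$, and let $\mathscr{R}^-_n=\Psi\!\left(\binom{x+1}{2}^n\right)$ for $n\ge0$ (so $\mathscr{R}^-_1=-1/6$). Let $(R_n)_{n\ge0}$ be the Racah polynomials with parameters $(\alpha,\beta,\gamma,\delta)=(-1/2,1,0,0)$, and let $\Lambda$ be the unique linear form on $\mathbb{Q}[y]$ with $\Lambda(1)=1$ and $\Lambda(R_n)=0$ for all $n>0$. Then $\Lambda(y^n)=2^n\mathscr{R}^-_{n+1}/\mathscr{R}^-_1$ for all $n\ge 0$, i.e. the numbers $(2^n\mathscr{R}^-_{n+1}/\mathscr{R}^-_1)_{n\ge0}$ are the moments of this family of orthogonal polynomials.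
   Context: For parameters $\alpha,\beta,\gamma,\delta$, the Racah polynomial $R_n$ is the polynomial of degree $n$ in a variable $y$ such that, with $\lambda(x)=x(x+\gamma+\delta+1)$, $$R_n(\lambda(x))=\sum_{k=0}^{n}\frac{(-n)_k(n+\alpha+\beta+1)_k(-x)_k(x+\gamma+\delta+1)_k}{(\alpha+1)_k(\beta+\delta+1)_k(\gamma+1)_k\,k!},$$ where $(a)_k=a(a+1)\cdots(a+k-1)$ is the Pochhammer symbol. The "moments" of the family are $\Lambda(y^n)$, $n\ge 0$. -}

module Defs where

open import Data.Nat as ℕ using (ℕ; zero; suc)
open import Data.Nat.Base using (_!)
open import Data.Integer as ℤ using (+_)
open import Data.Rational using (ℚ; 0ℚ; 1ℚ; _+_; _*_; _-_; -_; _÷_; _/_; ≢-nonZero)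
open import Data.Rational.Properties using (_≟_)
open import Data.List using (List; []; _∷_; foldr; length; _++_; lookup)
open import Relation.Nullary using (yes; no)

ℕ→ℚ : ℕ → ℚ
ℕ→ℚ n = + n / 1

-- total division on ℚ (x / 0 := 0); only ever applied to nonzero denominators here
_÷'_ : ℚ → ℚ → ℚ
p ÷' q with q ≟ 0ℚ
... | yes _ = 0ℚ
... | no q≢0 = _÷_ p q {{≢-nonZero q≢0}}

Σ< : ℕ → (ℕ → ℚ) → ℚ
Σ< zero    f = 0ℚ
Σ< (suc n) f = Σ< n f + f n

Π< : ℕ → (ℕ → ℚ) → ℚ
Π< zero    f = 1ℚ
Π< (suc n) f = Π< n f * f n

_^ℚ_ : ℚ → ℕ → ℚ
p ^ℚ zero  = 1ℚ
p ^ℚ suc n = (p ^ℚ n) * p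

poch : ℚ → ℕ → ℚ
poch a k = Π< k (λ j → a + ℕ→ℚ j)

-- Bernoulli numbers, t/(e^t - 1) = Σ B_n t^n / n!.
-- Equivalently (Σ_n B_n t^n/n!) · (Σ_m t^m/(m+1)!) = 1, i.e. coefficientwise
--   Σ_{k=0}^{n} B_k/k! · 1/(n-k+1)! = [n = 0],
-- so B_0 = 1 and B_n = - n! · Σ_{k<n} B_k / (k! (n-k+1)!).

bernNext : List ℚ → ℚ
bernNext l = - (ℕ→ℚ (n !) * go l 0)
  where
  n = length l
  go : List ℚ → ℕ → ℚ
  go []      k = 0ℚ
  go (b ∷ bs) k = (b ÷' (ℕ→ℚ (k !) * ℕ→ℚ (suc (n ℕ.∸ k) !))) + go bs (suc k)

bernList : ℕ → List ℚ
bernList zero    = 1ℚ ∷ []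
bernList (suc n) = bernList n ++ (bernNext (bernList n) ∷ [])

lastOr : ℚ → List ℚ → ℚ
lastOr d []       = d
lastOr d (x ∷ xs) = lastOr x xs

bernoulli : ℕ → ℚ
bernoulli n = lastOr 0ℚ (bernList n)

-- Polynomials over ℚ as coefficient lists (lowest degree first).

Poly : Set
Poly = List ℚ

addP : Poly → Poly → Poly
addP []       q        = q
addP p        []       = p
addP (a ∷ p)  (b ∷ q)  = (a + b) ∷ addP p q

scaleP : ℚ → Poly → Poly
scaleP c []      = []
scaleP c (a ∷ p) = (c * a) ∷ scaleP c p

mulP : Poly → Poly → Poly
mulP []      q = []
mulP (a ∷ p) q = addP (scaleP a q) (0ℚ ∷ mulP p q)

powP : Poly → ℕ → Poly
powP p zero    = 1ℚ ∷ []
powP p (suc n) = mulP (powP p n) p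

-- apply the linear form with values m i on the monomials (variable)^i
applyLF : (ℕ → ℚ) → Poly → ℚ
applyLF m p = go p 0
  where
  go : Poly → ℕ → ℚ
  go []      i = 0ℚ
  go (a ∷ q) i = a * m i + go q (suc i)

Ψ : Poly → ℚ
Ψ = applyLF bernoulli

binomX+1-2 : Poly
binomX+1-2 = 0ℚ ∷ (1ℚ ÷' ℕ→ℚ 2) ∷ (1ℚ ÷' ℕ→ℚ 2) ∷ []

ℛ⁻ : ℕ → ℚ
ℛ⁻ n = Ψ (powP binomX+1-2 n)

-- Racah polynomials R_n(y; α, β, γ, δ) as polynomials in y = λ(x) = x(x+γ+δ+1).
-- Since (j - x)(x + γ+δ+1 + j) = j(j+γ+δ+1) - λ(x), we have
--   (-x)_k (x+γ+δ+1)_k = Π_{j<k} (j(j+γ+δ+1) - y)   with y = λ(x),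
-- hence R_n(y) = Σ_{k=0}^{n} c_k Π_{j<k} (j(j+γ+δ+1) - y) with the
-- hypergeometric coefficients c_k below.

racahBasis : ℚ → ℕ → Poly
racahBasis s zero    = 1ℚ ∷ []
racahBasis s (suc k) =
  mulP (racahBasis s k) ((ℕ→ℚ k * (ℕ→ℚ k + s)) ∷ (- 1ℚ) ∷ [])

racahCoeff : (α β γ δ : ℚ) → ℕ → ℕ → ℚ
racahCoeff α β γ δ n k =
  (poch (- ℕ→ℚ n) k * poch (ℕ→ℚ n + α + β + 1ℚ) k)
  ÷' (poch (α + 1ℚ) k * poch (β + δ + 1ℚ) k * poch (γ + 1ℚ) k * ℕ→ℚ (k !))

racah : (α β γ δ : ℚ) → ℕ → Poly
racah α β γ δ n = go (suc n)
  where
  go : ℕ → Poly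
  go zero    = []
  go (suc k) = addP (go k) (scaleP (racahCoeff α β γ δ n k) (racahBasis (γ + δ + 1ℚ) k))

R : ℕ → Poly
R = racah (- (1ℚ ÷' ℕ→ℚ 2)) 1ℚ 0ℚ 0ℚ

claimedMoment : ℕ → ℚ
claimedMoment n = ((ℕ→ℚ 2 ^ℚ n) * ℛ⁻ (suc n)) ÷' ℛ⁻ 1

{-# OPTIONS --safe #-}

-- Put y = x (x + 1) and p_k = Π_{j<k} (j (j + 1) − y) = (−x)_k (x + 1)_k.  The claimed
-- moments belong to the form Λ(f) = −3 Ψ(y f(y)).  Since (x − k) p_k has forward difference
-- (2k + 1) p_k and linear coefficient k!², the rule Ψ(f(x + 1)) − Ψ(f(x)) = f′(0) gives
-- Ψ(p_k) = k!² / (2k + 1), hence (2k + 1) (2k + 3) Λ(p_k) = 3 (k + 1) k!².  Therefore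
-- Λ(R_n) = ₂F₁(−n, n + 3/2; 5/2; 1), whose partial sums have a closed form vanishing at
-- order n > 0.  Uniqueness holds because R_n is triangular in the p_k with nonzero diagonal.
module Submission where

open import Defs
open import Data.Nat as ℕ using (ℕ; zero; suc; _!)
open import Data.Rational
open import Data.Product using (_×_; _,_)
open import Relation.Binary.PropositionalEquality
open import Function.Bundles using (_⇔_; mk⇔)
open import Function using (id; _∘_)
open import Relation.Nullary using (yes; no; contradiction)
open import Data.List using (List; []; _∷_; _++_; length; applyUpTo)
open import Data.List.Properties using (length-applyUpTo; applyUpTo-∷ʳ)
import Data.Nat.Properties as ℕ
import Data.Nat.Induction as ℕ
import Data.Integer as ℤ
import Data.Integer.Properties as ℤ
import Data.Rational.Unnormalised as ℚᵘ
import Data.Rational.Unnormalised.Properties as ℚᵘ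
open import Data.Rational.Properties
open import Data.Rational.Solver
open +-*-Solver
open import Algebra.Properties.Group +-0-group using () renaming (∙-cancelˡ to +-cancelˡ)

-- Rational arithmetic

-- Normalisation in `ℚ` involves a gcd that does not reduce for a variable `n`. Over the
-- unnormalised rationals only an equation of integers remains.
ℕ→ℚ-suc : ∀ n → ℕ→ℚ (suc n) ≡ 1ℚ + ℕ→ℚ n
ℕ→ℚ-suc n = toℚᵘ-injective (begin
  toℚᵘ (ℕ→ℚ (suc n))
    ≈⟨ toℚᵘ-fromℚᵘ (ℚᵘ.mkℚᵘ (ℤ.+ suc n) 0) ⟩
  ℚᵘ.mkℚᵘ (ℤ.+ suc n) 0
    ≈⟨ ℚᵘ.*≡* (cong (λ x → (ℤ.+ 1 ℤ.+ x) ℤ.* ℤ.+ 1) (sym (ℤ.*-identityʳ (ℤ.+ n)))) ⟩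
  ℚᵘ.1ℚᵘ ℚᵘ.+ ℚᵘ.mkℚᵘ (ℤ.+ n) 0
    ≈⟨ ℚᵘ.+-congʳ ℚᵘ.1ℚᵘ (toℚᵘ-fromℚᵘ (ℚᵘ.mkℚᵘ (ℤ.+ n) 0)) ⟨
  toℚᵘ 1ℚ ℚᵘ.+ toℚᵘ (ℕ→ℚ n)
    ≈⟨ toℚᵘ-homo-+ 1ℚ (ℕ→ℚ n) ⟨
  toℚᵘ (1ℚ + ℕ→ℚ n) ∎)
  where open ℚᵘ.≃-Reasoning

open ≡-Reasoning

ℕ→ℚ-homo-+ : ∀ m n → ℕ→ℚ (m ℕ.+ n) ≡ ℕ→ℚ m + ℕ→ℚ n
ℕ→ℚ-homo-+ zero    n = sym (+-identityˡ (ℕ→ℚ n))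
ℕ→ℚ-homo-+ (suc m) n = begin
  ℕ→ℚ (suc (m ℕ.+ n))      ≡⟨ ℕ→ℚ-suc (m ℕ.+ n) ⟩
  1ℚ + ℕ→ℚ (m ℕ.+ n)       ≡⟨ cong (λ x → 1ℚ + x) (ℕ→ℚ-homo-+ m n) ⟩
  1ℚ + (ℕ→ℚ m + ℕ→ℚ n)     ≡⟨ +-assoc 1ℚ (ℕ→ℚ m) (ℕ→ℚ n) ⟨
  (1ℚ + ℕ→ℚ m) + ℕ→ℚ n     ≡⟨ cong (_+ ℕ→ℚ n) (ℕ→ℚ-suc m) ⟨
  ℕ→ℚ (suc m) + ℕ→ℚ n      ∎

ℕ→ℚ-homo-* : ∀ m n → ℕ→ℚ (m ℕ.* n) ≡ ℕ→ℚ m * ℕ→ℚ n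
ℕ→ℚ-homo-* zero    n = sym (*-zeroˡ (ℕ→ℚ n))
ℕ→ℚ-homo-* (suc m) n = begin
  ℕ→ℚ (n ℕ.+ m ℕ.* n)          ≡⟨ ℕ→ℚ-homo-+ n (m ℕ.* n) ⟩
  ℕ→ℚ n + ℕ→ℚ (m ℕ.* n)        ≡⟨ cong (ℕ→ℚ n +_) (ℕ→ℚ-homo-* m n) ⟩
  ℕ→ℚ n + ℕ→ℚ m * ℕ→ℚ n        ≡⟨ solve 2 (λ m n → n :+ m :* n := (con 1ℚ :+ m) :* n) refl (ℕ→ℚ m) (ℕ→ℚ n) ⟩
  (1ℚ + ℕ→ℚ m) * ℕ→ℚ n         ≡⟨ cong (_* ℕ→ℚ n) (ℕ→ℚ-suc m) ⟨
  ℕ→ℚ (suc m) * ℕ→ℚ n          ∎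

ℕ→ℚ-nonNeg : ∀ n → NonNegative (ℕ→ℚ n)
ℕ→ℚ-nonNeg n = normalize-nonNeg n 1

pos+ℕ→ℚ : ∀ a .{{_ : Positive a}} n → Positive (a + ℕ→ℚ n)
pos+ℕ→ℚ a n = pos+nonNeg⇒pos a (ℕ→ℚ n) {{ℕ→ℚ-nonNeg n}}

ℕ→ℚ-pos : ∀ n .{{_ : ℕ.NonZero n}} → Positive (ℕ→ℚ n)
ℕ→ℚ-pos n = normalize-pos n 1

pos⇒≢0 : ∀ p → .(Positive p) → p ≢ 0ℚ
pos⇒≢0 p p>0 refl = contradiction refl (<⇒≢ (positive⁻¹ 0ℚ {{p>0}}))

*-cancelʳ-≢0 : ∀ {p q} r → r ≢ 0ℚ → p * r ≡ q * r → p ≡ q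
*-cancelʳ-≢0 {p} {q} r r≢0 eq = begin
  p                ≡⟨ undo p ⟨
  p * r * 1/ r     ≡⟨ cong (_* 1/ r) eq ⟩
  q * r * 1/ r     ≡⟨ undo q ⟩
  q                ∎
  where
  instance _ = ≢-nonZero r≢0
  undo : ∀ x → x * r * 1/ r ≡ x
  undo x = trans (*-assoc x r (1/ r)) (trans (cong (x *_) (*-inverseʳ r)) (*-identityʳ x))

*-≢0 : ∀ {p q} → p ≢ 0ℚ → q ≢ 0ℚ → p * q ≢ 0ℚ
*-≢0 {p} {q} p≢0 q≢0 eq = p≢0 (*-cancelʳ-≢0 q q≢0 (trans eq (sym (*-zeroˡ q))))

÷′-*-cancel : ∀ p {q} → q ≢ 0ℚ → (p ÷' q) * q ≡ p
÷′-*-cancel p {q} q≢0 with q ≟ 0ℚ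
... | yes q≡0 = contradiction q≡0 q≢0
... | no  nz  = trans (*-assoc p _ q) (trans (cong (p *_) (*-inverseˡ q {{≢-nonZero nz}})) (*-identityʳ p))

÷′-unique : ∀ {x p q} → q ≢ 0ℚ → x * q ≡ p → x ≡ p ÷' q
÷′-unique {p = p} {q} q≢0 eq = *-cancelʳ-≢0 q q≢0 (trans eq (sym (÷′-*-cancel p q≢0)))

n!≢0 : ∀ n → ℕ→ℚ (n !) ≢ 0ℚ
n!≢0 n = pos⇒≢0 _ (ℕ→ℚ-pos (n !) {{n ℕ.!≢0}})

1/! : ℕ → ℚ
1/! n = 1ℚ ÷' ℕ→ℚ (n !)

1/!-cancel : ∀ n → 1/! n * ℕ→ℚ (n !) ≡ 1ℚ
1/!-cancel n = ÷′-*-cancel 1ℚ (n!≢0 n)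

ℕ→ℚ-suc! : ∀ n → ℕ→ℚ (suc n !) ≡ (1ℚ + ℕ→ℚ n) * ℕ→ℚ (n !)
ℕ→ℚ-suc! n = trans (ℕ→ℚ-homo-* (suc n) (n !)) (cong (_* ℕ→ℚ (n !)) (ℕ→ℚ-suc n))

1/!-suc : ∀ n → (1ℚ + ℕ→ℚ n) * 1/! (suc n) ≡ 1/! n
1/!-suc n = ÷′-unique (n!≢0 n) (begin
  (1ℚ + ℕ→ℚ n) * 1/! (suc n) * ℕ→ℚ (n !)
    ≡⟨ solve 3 (λ x y z → x :* y :* z := y :* (x :* z)) refl (1ℚ + ℕ→ℚ n) (1/! (suc n)) (ℕ→ℚ (n !)) ⟩
  1/! (suc n) * ((1ℚ + ℕ→ℚ n) * ℕ→ℚ (n !))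
    ≡⟨ cong (1/! (suc n) *_) (ℕ→ℚ-suc! n) ⟨
  1/! (suc n) * ℕ→ℚ (suc n !)
    ≡⟨ 1/!-cancel (suc n) ⟩
  1ℚ ∎)

-- Linear forms as sequences

-- Linearity is stated up to pointwise equality. An arbitrary operator on sequences need not respect
-- `≗`, so `≗-cong` is a field.
record IsLinear (W : (ℕ → ℚ) → ℕ → ℚ) : Set where
  field
    ≗-cong : ∀ {f g} → f ≗ g → W f ≗ W g
    +-homo : ∀ f g → W (λ n → f n + g n) ≗ λ n → W f n + W g n
    *-homo : ∀ a f → W (λ n → a * f n) ≗ λ n → a * W f n

open IsLinear

id-linear : IsLinear id
id-linear = record { ≗-cong = id ; +-homo = λ _ _ _ → refl ; *-homo = λ _ _ _ → refl }

∘-linear : ∀ {U W} → IsLinear U → IsLinear W → IsLinear (U ∘ W)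
∘-linear {W = W} u w = record
  { ≗-cong = ≗-cong u ∘ ≗-cong w
  ; +-homo = λ f g n → trans (≗-cong u (+-homo w f g) n) (+-homo u (W f) (W g) n)
  ; *-homo = λ a f n → trans (≗-cong u (*-homo w a f) n) (*-homo u a (W f) n)
  }

+-linear : ∀ {U W} → IsLinear U → IsLinear W → IsLinear (λ f n → U f n + W f n)
+-linear {U} {W} u w = record
  { ≗-cong = λ p n → cong₂ _+_ (≗-cong u p n) (≗-cong w p n)
  ; +-homo = λ f g n → trans (cong₂ _+_ (+-homo u f g n) (+-homo w f g n))
      (solve 4 (λ a b c d → (a :+ b) :+ (c :+ d) := (a :+ c) :+ (b :+ d)) refl
        (U f n) (U g n) (W f n) (W g n))
  ; *-homo = λ a f n → trans (cong₂ _+_ (*-homo u a f n) (*-homo w a f n))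
      (sym (*-distribˡ-+ a (U f n) (W f n)))
  }

scale-linear : ∀ c → IsLinear (λ f n → c * f n)
scale-linear c = record
  { ≗-cong = λ p n → cong (c *_) (p n)
  ; +-homo = λ f g n → *-distribˡ-+ c (f n) (g n)
  ; *-homo = λ a f n → solve 3 (λ c a x → c :* (a :* x) := a :* (c :* x)) refl c a (f n)
  }

neg-linear : IsLinear (λ f n → - f n)
neg-linear = record
  { ≗-cong = λ p n → cong -_ (p n)
  ; +-homo = λ f g n → neg-distrib-+ (f n) (g n)
  ; *-homo = λ a f n → neg-distribʳ-* a (f n)
  }

-- A sequence m stands for the linear form xⁿ ↦ m n; S, E, Y and Y⁺ are then the
-- duals of multiplication by x, x + 1, x (x + 1) and (x + 1)(x + 2).
S E Y Y⁺ : (ℕ → ℚ) → ℕ → ℚ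
S m n = m (suc n)
E m n = m n + S m n
Y m n = S m n + S (S m) n
Y⁺ m n = E m n + E (E m) n

S-linear : IsLinear S
S-linear = record { ≗-cong = λ p n → p (suc n) ; +-homo = λ _ _ _ → refl ; *-homo = λ _ _ _ → refl }

E-linear : IsLinear E
E-linear = +-linear id-linear S-linear

Y-linear : IsLinear Y
Y-linear = +-linear S-linear (∘-linear S-linear S-linear)

-- If A is dual to multiplication by a polynomial q, then V A m n is the value of m on qⁿ.
V : ((ℕ → ℚ) → ℕ → ℚ) → (ℕ → ℚ) → ℕ → ℚ
V A m zero    = m 0
V A m (suc n) = V A (A m) n

V-linear : ∀ {A} → IsLinear A → IsLinear (V A)
V-linear {A} a = record { ≗-cong = cg ; +-homo = ad ; *-homo = sc }
  where
  cg : ∀ {f g} → f ≗ g → V A f ≗ V A g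
  cg p zero    = p 0
  cg p (suc n) = cg (≗-cong a p) n
  ad : ∀ f g → V A (λ n → f n + g n) ≗ λ n → V A f n + V A g n
  ad f g zero    = refl
  ad f g (suc n) = trans (cg (+-homo a f g) n) (ad (A f) (A g) n)
  sc : ∀ c f → V A (λ n → c * f n) ≗ λ n → c * V A f n
  sc c f zero    = refl
  sc c f (suc n) = trans (cg (*-homo a c f) n) (sc c (A f) n)

step : ((ℕ → ℚ) → ℕ → ℚ) → ℚ → (ℕ → ℚ) → ℕ → ℚ
step A c m n = c * m n - A m n

step-linear : ∀ {A} → IsLinear A → ∀ c → IsLinear (step A c)
step-linear a c = +-linear (scale-linear c) (∘-linear neg-linear a)

node : ℕ → ℚ
node k = ℕ→ℚ k * (ℕ→ℚ k + 1ℚ)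

-- D A k is the operator Π_{j<k} (j (j + 1) − A).
D : ((ℕ → ℚ) → ℕ → ℚ) → ℕ → (ℕ → ℚ) → ℕ → ℚ
D A zero    m = m
D A (suc k) m = step A (node k) (D A k m)

D-linear : ∀ {A} → IsLinear A → ∀ k → IsLinear (D A k)
D-linear a zero    = id-linear
D-linear a (suc k) = ∘-linear (step-linear a (node k)) (D-linear a k)

-- A linear `W` that carries `A′` to `A` also carries every polynomial in `A′` to the same
-- polynomial in `A`. Substitutions (`V E`, `V Y`) and the commuting of polynomials in `S` are both
-- instances.
D-intertwine : ∀ {A A′ W} → IsLinear A → IsLinear W → (∀ m → A (W m) ≗ W (A′ m)) →
  ∀ k m → D A k (W m) ≗ W (D A′ k m)
D-intertwine a w comm zero m n = refl
D-intertwine {A} {A′} {W} a w comm (suc k) m n = begin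
  node k * D A k (W m) n - A (D A k (W m)) n
    ≡⟨ ≗-cong (step-linear a (node k)) (D-intertwine a w comm k m) n ⟩
  node k * W u n - A (W u) n
    ≡⟨ cong₂ (λ x y → x - y) (sym (*-homo w (node k) u n)) (comm u n) ⟩
  W (λ i → node k * u i) n - W (A′ u) n
    ≡⟨ solve 2 (λ x y → x :- y := x :+ con (- 1ℚ) :* y) refl (W (λ i → node k * u i) n) (W (A′ u) n) ⟩
  W (λ i → node k * u i) n + - 1ℚ * W (A′ u) n
    ≡⟨ cong (W (λ i → node k * u i) n +_) (*-homo w (- 1ℚ) (A′ u) n) ⟨
  W (λ i → node k * u i) n + W (λ i → - 1ℚ * A′ u i) n
    ≡⟨ +-homo w (λ i → node k * u i) (λ i → - 1ℚ * A′ u i) n ⟨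
  W (λ i → node k * u i + - 1ℚ * A′ u i) n
    ≡⟨ ≗-cong w (λ i → solve 2 (λ x y → x :+ con (- 1ℚ) :* y := x :- y) refl (node k * u i) (A′ u i)) n ⟩
  W (D A′ (suc k) m) n ∎
  where
  u = D A′ k m

-- Evaluation of linear forms on coefficient lists

-- The recursion shifts the sequence instead of an index, so the tail of a list is evaluated by the
-- dual of multiplication by the variable.
L : (ℕ → ℚ) → Poly → ℚ
L m []      = 0ℚ
L m (a ∷ p) = a * m 0 + L (S m) p

L-cong : ∀ {m m′} → m ≗ m′ → ∀ p → L m p ≡ L m′ p
L-cong e []      = refl
L-cong e (a ∷ p) = cong₂ (λ x y → a * x + y) (e 0) (L-cong (e ∘ suc) p)

L-addP : ∀ m p q → L m (addP p q) ≡ L m p + L m q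
L-addP m []      q       = sym (+-identityˡ (L m q))
L-addP m (a ∷ p) []      = sym (+-identityʳ _)
L-addP m (a ∷ p) (b ∷ q) = trans (cong ((a + b) * m 0 +_) (L-addP (S m) p q))
  (solve 5 (λ a b x y z → (a :+ b) :* x :+ (y :+ z) := (a :* x :+ y) :+ (b :* x :+ z)) refl
    a b (m 0) (L (S m) p) (L (S m) q))

L-scaleP : ∀ m c p → L m (scaleP c p) ≡ c * L m p
L-scaleP m c []      = sym (*-zeroʳ c)
L-scaleP m c (a ∷ p) = trans (cong (c * a * m 0 +_) (L-scaleP (S m) c p))
  (solve 4 (λ c a x y → c :* a :* x :+ c :* y := c :* (a :* x :+ y)) refl c a (m 0) (L (S m) p))

-- For fixed q, the form p ↦ m(p q) has as its moments the values of m on xⁿ q.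
L-mulP : ∀ m p q → L m (mulP p q) ≡ L (λ n → L (λ i → m (n ℕ.+ i)) q) p
L-mulP m []      q = refl
L-mulP m (a ∷ p) q = begin
  L m (addP (scaleP a q) (0ℚ ∷ mulP p q))
    ≡⟨ L-addP m (scaleP a q) (0ℚ ∷ mulP p q) ⟩
  L m (scaleP a q) + (0ℚ * m 0 + L (S m) (mulP p q))
    ≡⟨ cong₂ _+_ (L-scaleP m a q) (cong₂ _+_ (*-zeroˡ (m 0)) (L-mulP (S m) p q)) ⟩
  a * L m q + (0ℚ + L (λ n → L (λ i → S m (n ℕ.+ i)) q) p)
    ≡⟨ cong (a * L m q +_) (+-identityˡ _) ⟩
  L (λ n → L (λ i → m (n ℕ.+ i)) q) (a ∷ p) ∎

lf : (ℕ → ℚ) → Poly → ℕ → ℚ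
lf m []      i = 0ℚ
lf m (a ∷ q) i = a * m i + lf m q (suc i)

-- The local `go` of applyLF has no name here.  With its arguments abstracted to distinct
-- variables, unification solves the `_` in the type of lf-go to it; the same device
-- serves bernNext and racah below.
mutual
  lf-go : ∀ m p q i → _ ≡ lf m q i
  applyLF-go : ∀ m p → applyLF m p ≡ lf m p 0
  applyLF-go m [] = refl
  applyLF-go m (a ∷ q) with a ∷ q | 1
  ... | p | k = cong (a * m 0 +_) (lf-go m p q k)
  lf-go m p [] i = refl
  lf-go m p (a ∷ q) i = cong (a * m i +_) (lf-go m p q (suc i))

lf≡L : ∀ m p i → lf m p i ≡ L (λ n → m (n ℕ.+ i)) p
lf≡L m []      i = refl
lf≡L m (a ∷ p) i = cong (a * m i +_) (trans (lf≡L m p (suc i))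
  (L-cong (λ n → cong m (ℕ.+-suc n i)) p))

applyLF≡L : ∀ m p → applyLF m p ≡ L m p
applyLF≡L m p = trans (applyLF-go m p) (trans (lf≡L m p 0) (L-cong (λ n → cong m (ℕ.+-identityʳ n)) p))

-- The Bernoulli functional

-- The summation local to `bernNext`, with the full list `l` kept apart from the part still to be
-- summed, since the denominators use the full length.
bernSum : List ℚ → List ℚ → ℕ → ℚ
bernSum l []       k = 0ℚ
bernSum l (b ∷ bs) k = (b ÷' (ℕ→ℚ (k !) * ℕ→ℚ (suc (length l ℕ.∸ k) !))) + bernSum l bs (suc k)

mutual
  bernNext≡ : ∀ l → bernNext l ≡ - (ℕ→ℚ (length l !) * bernSum l l 0)
  bernNext≡ []       = refl
  bernNext≡ (b ∷ bs) =
    cong (λ x → - (ℕ→ℚ (length (b ∷ bs) !) * ((b ÷' (ℕ→ℚ 1 * ℕ→ℚ ((2 ℕ.+ length bs) !))) + x)))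
      (bern-go-tail b bs)

  bern-go-tail : ∀ b bs → _ ≡ bernSum (b ∷ bs) bs 1
  bern-go-tail b bs with b ∷ bs | 1
  ... | l | k = bern-go≡ l bs k

  bern-go≡ : ∀ l bs k → _ ≡ bernSum l bs k
  bern-go≡ l []       k = refl
  bern-go≡ l (b ∷ bs) k =
    cong ((b ÷' (ℕ→ℚ (k !) * ℕ→ℚ (suc (length l ℕ.∸ k) !))) +_) (bern-go≡ l bs (suc k))

-- H m N a is the sum of m j / ((a + j)! (N − 1 − j)!) over j < N.
H : (ℕ → ℚ) → ℕ → ℕ → ℚ
H m zero    a = 0ℚ
H m (suc N) a = m 0 * (1/! a * 1/! N) + H (S m) N (suc a)

H-E : ∀ m N a → H (E m) N a ≡ H m N a + H (S m) N a
H-E m zero    a = refl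
H-E m (suc N) a = trans (cong (E m 0 * w +_) (H-E (S m) N (suc a)))
  (solve 5 (λ x y w p q → (x :+ y) :* w :+ (p :+ q) := (x :* w :+ p) :+ (y :* w :+ q)) refl
    (m 0) (m 1) w (H (S m) N (suc a)) (H (S (S m)) N (suc a)))
  where w = 1/! a * 1/! N

-- Split the factor N + a + 1 as (a + 1 + j) + (N - j) in the term with index j. The first summand
-- lowers one factorial, the second lowers the other and kills the term j = N.
H-pascal-suc : ∀ m N a →
  (1ℚ + ℕ→ℚ (N ℕ.+ a)) * H m (suc N) (suc a) ≡ H m (suc N) a + H m N (suc a)
H-pascal-suc m zero a = begin
  (1ℚ + α) * (x * (1/! (suc a) * 1ℚ) + 0ℚ)
    ≡⟨ solve 3 (λ α x i → (con 1ℚ :+ α) :* (x :* (i :* con 1ℚ) :+ con 0ℚ)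
                          := x :* (((con 1ℚ :+ α) :* i) :* con 1ℚ) :+ con 0ℚ :+ con 0ℚ) refl α x (1/! (suc a)) ⟩
  x * ((1ℚ + α) * 1/! (suc a) * 1ℚ) + 0ℚ + 0ℚ
    ≡⟨ cong (λ i → x * (i * 1ℚ) + 0ℚ + 0ℚ) (1/!-suc a) ⟩
  x * (1/! a * 1ℚ) + 0ℚ + 0ℚ ∎
  where
  α = ℕ→ℚ a
  x = m 0
H-pascal-suc m (suc N) a = begin
  (1ℚ + s) * (x * (ia′ * iN′) + h₂)
    ≡⟨ cong (λ s → (1ℚ + s) * (x * (ia′ * iN′) + h₂)) (trans (ℕ→ℚ-suc (N ℕ.+ a)) (cong (1ℚ +_) (ℕ→ℚ-homo-+ N a))) ⟩
  (1ℚ + (1ℚ + (ν + α))) * (x * (ia′ * iN′) + h₂)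
    ≡⟨ solve 6 (λ ν α x i j h → (con 1ℚ :+ (con 1ℚ :+ (ν :+ α))) :* (x :* (i :* j) :+ h)
          := x :* (((con 1ℚ :+ α) :* i) :* j) :+ x :* (i :* ((con 1ℚ :+ ν) :* j))
             :+ (con 1ℚ :+ (ν :+ (con 1ℚ :+ α))) :* h) refl ν α x ia′ iN′ h₂ ⟩
  x * ((1ℚ + α) * ia′ * iN′) + x * (ia′ * ((1ℚ + ν) * iN′)) + (1ℚ + (ν + (1ℚ + α))) * h₂
    ≡⟨ cong₂ (λ i j → x * (i * iN′) + x * (ia′ * j) + (1ℚ + (ν + (1ℚ + α))) * h₂) (1/!-suc a) (1/!-suc N) ⟩
  x * (1/! a * iN′) + x * (ia′ * 1/! N) + (1ℚ + (ν + (1ℚ + α))) * h₂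
    ≡⟨ cong (λ s → x * (1/! a * iN′) + x * (ia′ * 1/! N) + (1ℚ + s) * h₂)
         (trans (cong (ν +_) (sym (ℕ→ℚ-suc a))) (sym (ℕ→ℚ-homo-+ N (suc a)))) ⟩
  x * (1/! a * iN′) + x * (ia′ * 1/! N) + (1ℚ + ℕ→ℚ (N ℕ.+ suc a)) * h₂
    ≡⟨ cong (x * (1/! a * iN′) + x * (ia′ * 1/! N) +_) (H-pascal-suc (S m) N (suc a)) ⟩
  x * (1/! a * iN′) + x * (ia′ * 1/! N) + (H (S m) (suc N) (suc a) + H (S m) N (suc (suc a)))
    ≡⟨ solve 4 (λ p q r s → p :+ q :+ (r :+ s) := (p :+ r) :+ (q :+ s)) refl
         (x * (1/! a * iN′)) (x * (ia′ * 1/! N)) (H (S m) (suc N) (suc a)) (H (S m) N (suc (suc a))) ⟩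
  H m (suc (suc N)) a + H m (suc N) (suc a) ∎
  where
  ν = ℕ→ℚ N
  α = ℕ→ℚ a
  s = ℕ→ℚ (suc N ℕ.+ a)
  x = m 0
  ia′ = 1/! (suc a)
  iN′ = 1/! (suc N)
  h₂ = H (S m) (suc N) (suc (suc a))

-- Pascal's rule for binomial coefficients divided by factorials. The term j = 0 is split off,
-- because the other terms have the positive offset that `H-pascal-suc` requires.
H-pascal : ∀ m N → (1ℚ + ℕ→ℚ N) * H m (suc (suc N)) 0 ≡ H (E m) (suc N) 0
H-pascal m N = begin
  (1ℚ + ν) * (x * (1ℚ * iN′) + h)
    ≡⟨ solve 4 (λ ν x i h → (con 1ℚ :+ ν) :* (x :* (con 1ℚ :* i) :+ h)
          := x :* (con 1ℚ :* ((con 1ℚ :+ ν) :* i)) :+ (con 1ℚ :+ ν) :* h) refl ν x iN′ h ⟩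
  x * (1ℚ * ((1ℚ + ν) * iN′)) + (1ℚ + ν) * h
    ≡⟨ cong₂ (λ i N → x * (1ℚ * i) + (1ℚ + ℕ→ℚ N) * h) (1/!-suc N) (sym (ℕ.+-identityʳ N)) ⟩
  x * (1ℚ * 1/! N) + (1ℚ + ℕ→ℚ (N ℕ.+ 0)) * h
    ≡⟨ cong (x * (1ℚ * 1/! N) +_) (H-pascal-suc (S m) N 0) ⟩
  x * (1ℚ * 1/! N) + (H (S m) (suc N) 0 + H (S m) N 1)
    ≡⟨ solve 3 (λ p q r → p :+ (q :+ r) := (p :+ r) :+ q) refl (x * (1ℚ * 1/! N)) (H (S m) (suc N) 0) (H (S m) N 1) ⟩
  H m (suc N) 0 + H (S m) (suc N) 0
    ≡⟨ H-E m (suc N) 0 ⟨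
  H (E m) (suc N) 0 ∎
  where
  ν = ℕ→ℚ N
  x = m 0
  iN′ = 1/! (suc N)
  h = H (S m) (suc N) 1

-- The binomial theorem for (x + 1)ⁿ: n! times the reciprocal factorials in `H m (suc n) 0` gives
-- the binomial coefficients.
V-E≡H : ∀ m n → V E m n ≡ ℕ→ℚ (n !) * H m (suc n) 0
V-E≡H m zero    = solve 1 (λ x → x := con 1ℚ :* (x :* (con 1ℚ :* con 1ℚ) :+ con 0ℚ)) refl (m 0)
V-E≡H m (suc n) = begin
  V E (E m) n                                       ≡⟨ V-E≡H (E m) n ⟩
  ℕ→ℚ (n !) * H (E m) (suc n) 0                     ≡⟨ cong (ℕ→ℚ (n !) *_) (H-pascal m n) ⟨
  ℕ→ℚ (n !) * ((1ℚ + ℕ→ℚ n) * H m (2 ℕ.+ n) 0)      ≡⟨ solve 3 (λ f s h → f :* (s :* h) := s :* f :* h) refl (ℕ→ℚ (n !)) (1ℚ + ℕ→ℚ n) (H m (2 ℕ.+ n) 0) ⟩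
  (1ℚ + ℕ→ℚ n) * ℕ→ℚ (n !) * H m (2 ℕ.+ n) 0        ≡⟨ cong (_* H m (2 ℕ.+ n) 0) (ℕ→ℚ-suc! n) ⟨
  ℕ→ℚ (suc n !) * H m (2 ℕ.+ n) 0                   ∎

-- The length hypothesis makes the denominators agree term by term. `H` runs over two further
-- indices, whose second factors are 1/1! and 1/0!, both equal to 1.
bernSum≡H : ∀ l m N a → length l ≡ N ℕ.+ a →
  bernSum l (applyUpTo m N) a
    + (m N * (1/! (N ℕ.+ a) * 1ℚ) + m (suc N) * (1/! (suc (N ℕ.+ a)) * 1ℚ)) ≡ H m (2 ℕ.+ N) a
bernSum≡H l m zero a _ = solve 4 (λ x y i j → con 0ℚ :+ (x :* (i :* con 1ℚ) :+ y :* (j :* con 1ℚ))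
    := x :* (i :* con 1ℚ) :+ (y :* (j :* con 1ℚ) :+ con 0ℚ)) refl (m 0) (m 1) (1/! a) (1/! (suc a))
bernSum≡H l m (suc N) a eq = begin
  m 0 ÷' (ℕ→ℚ (a !) * ℕ→ℚ (suc (length l ℕ.∸ a) !)) + t + z (suc (N ℕ.+ a))
    ≡⟨ cong₂ (λ x n → x + t + z n) head (sym (ℕ.+-suc N a)) ⟩
  h + t + z (N ℕ.+ suc a)
    ≡⟨ +-assoc h _ _ ⟩
  h + (t + z (N ℕ.+ suc a))
    ≡⟨ cong (h +_) (bernSum≡H l (S m) N (suc a) (trans eq (sym (ℕ.+-suc N a)))) ⟩
  H m (3 ℕ.+ N) a ∎
  where
  t = bernSum l (applyUpTo (S m) N) (suc a)
  z : ℕ → ℚ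
  z n = m (suc N) * (1/! n * 1ℚ) + m (2 ℕ.+ N) * (1/! (suc n) * 1ℚ)
  h = m 0 * (1/! a * 1/! (2 ℕ.+ N))
  head : m 0 ÷' (ℕ→ℚ (a !) * ℕ→ℚ (suc (length l ℕ.∸ a) !)) ≡ h
  head rewrite eq | ℕ.m+n∸n≡m (suc N) a = sym (÷′-unique (*-≢0 (n!≢0 a) (n!≢0 (2 ℕ.+ N)))
    (trans (solve 5 (λ x i j f g → x :* (i :* j) :* (f :* g) := x :* (i :* f) :* (j :* g)) refl
             (m 0) (1/! a) (1/! (2 ℕ.+ N)) (ℕ→ℚ (a !)) (ℕ→ℚ ((2 ℕ.+ N) !)))
      (trans (cong₂ (λ x y → m 0 * x * y) (1/!-cancel a) (1/!-cancel (2 ℕ.+ N)))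
        (solve 1 (λ x → x :* con 1ℚ :* con 1ℚ := x) refl (m 0)))))

lastOr-++ : ∀ d l x → lastOr d (l ++ x ∷ []) ≡ x
lastOr-++ d []      x = refl
lastOr-++ d (y ∷ l) x = lastOr-++ y l x

bernoulli-suc : ∀ n → bernoulli (suc n) ≡ bernNext (bernList n)
bernoulli-suc n = lastOr-++ 0ℚ (bernList n) (bernNext (bernList n))

bernList≡ : ∀ n → bernList n ≡ applyUpTo bernoulli (suc n)
bernList≡ zero    = refl
bernList≡ (suc n) = trans (cong₂ (λ l x → l ++ x ∷ []) (bernList≡ n) (sym (bernoulli-suc n)))
  (applyUpTo-∷ʳ bernoulli (suc n))

-- The moments of the form f ↦ f′(0).
δ₁ : ℕ → ℚ
δ₁ 1 = 1ℚ
δ₁ _ = 0ℚ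

-- Ψ(f(x + 1)) = Ψ(f(x)) + f′(0)
V-E-bernoulli : ∀ n → V E bernoulli n ≡ bernoulli n + δ₁ n
V-E-bernoulli 0 = refl
V-E-bernoulli 1 = refl
V-E-bernoulli (suc (suc n)) = begin
  V E B (2 ℕ.+ n)
    ≡⟨ V-E≡H B (2 ℕ.+ n) ⟩
  f₂ * H B (3 ℕ.+ n) 0
    ≡⟨ cong (f₂ *_) (sym (bernSum≡H l B (suc n) 0 (trans (length-applyUpTo B (suc n)) (sym (ℕ.+-identityʳ (suc n)))))) ⟩
  f₂ * (s + (B (suc n) * (1/! (suc n ℕ.+ 0) * 1ℚ) + y * (1/! (suc (suc n ℕ.+ 0)) * 1ℚ)))
    -- The recurrence for `B (suc n)` makes its term cancel all earlier ones, so only the top term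
    -- `y` survives.
    ≡⟨ cong₂ (λ k x → f₂ * (s + (x * (1/! k * 1ℚ) + y * (1/! (suc k) * 1ℚ)))) (ℕ.+-identityʳ (suc n)) recurrence ⟩
  f₂ * (s + (- (f₁ * s) * (1/! (suc n) * 1ℚ) + y * (1/! (2 ℕ.+ n) * 1ℚ)))
    ≡⟨ solve 6 (λ f s g i y j → f :* (s :+ (:- (g :* s) :* (i :* con 1ℚ) :+ y :* (j :* con 1ℚ)))
          := f :* (s :+ :- ((i :* g) :* s)) :+ y :* (j :* f)) refl f₂ s f₁ (1/! (suc n)) y (1/! (2 ℕ.+ n)) ⟩
  f₂ * (s + - (1/! (suc n) * f₁ * s)) + y * (1/! (2 ℕ.+ n) * f₂)
    ≡⟨ cong₂ (λ p q → f₂ * (s + - (p * s)) + y * q) (1/!-cancel (suc n)) (1/!-cancel (2 ℕ.+ n)) ⟩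
  f₂ * (s + - (1ℚ * s)) + y * 1ℚ
    ≡⟨ solve 3 (λ f s y → f :* (s :+ :- (con 1ℚ :* s)) :+ y :* con 1ℚ := y :+ con 0ℚ) refl f₂ s y ⟩
  y + 0ℚ ∎
  where
  B = bernoulli
  l = applyUpTo B (suc n)
  y = B (2 ℕ.+ n)
  f₁ = ℕ→ℚ (suc n !)
  f₂ = ℕ→ℚ ((2 ℕ.+ n) !)
  s = bernSum l l 0
  recurrence : B (suc n) ≡ - (f₁ * s)
  recurrence = begin
    B (suc n)                                       ≡⟨ bernoulli-suc n ⟩
    bernNext (bernList n)                           ≡⟨ cong bernNext (bernList≡ n) ⟩
    bernNext l                                      ≡⟨ bernNext≡ l ⟩
    - (ℕ→ℚ (length l !) * s)   ≡⟨ cong (λ k → - (ℕ→ℚ (k !) * s)) (length-applyUpTo B (suc n)) ⟩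
    - (f₁ * s)                                      ∎

-- Values of the Bernoulli form on the basis p_k

-- (x + 1 − k) p_k(x + 1) = (x + 1 + k) p_k(x)
D-shift : ∀ k m n → E (D Y⁺ k m) n - ℕ→ℚ k * D Y⁺ k m n ≡ E (D Y k m) n + ℕ→ℚ k * D Y k m n
D-shift zero    m n = solve 2 (λ x y → x :- con 0ℚ :* y := x :+ con 0ℚ :* y) refl (E m n) (m n)
D-shift (suc k) m n rewrite ℕ→ℚ-suc k = begin
  (cκ * v n - Y⁺ v n) + (cκ * S v n - Y⁺ v (suc n)) - (1ℚ + κ) * (cκ * v n - Y⁺ v n)
    -- Both sides acquire the same operator factor: (E - (κ + 1)) (κ (κ + 1) - Y⁺) = ((κ + 1)² - E²)
    -- (E - κ) and (E + (κ + 1)) (κ (κ + 1) - Y) = ((κ + 1)² - E²) (E + κ).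
    ≡⟨ solve 5 (λ κ v₀ v₁ v₂ v₃ →
         let y₀ = (v₀ :+ v₁) :+ ((v₀ :+ v₁) :+ (v₁ :+ v₂))
             y₁ = (v₁ :+ v₂) :+ ((v₁ :+ v₂) :+ (v₂ :+ v₃))
             c = κ :* (κ :+ con 1ℚ)
         in (c :* v₀ :- y₀) :+ (c :* v₁ :- y₁) :- (con 1ℚ :+ κ) :* (c :* v₀ :- y₀)
            := F κ ((v₀ :+ v₁) :- κ :* v₀) ((v₁ :+ v₂) :- κ :* v₁) ((v₂ :+ v₃) :- κ :* v₂))
         refl κ (v n) (v (suc n)) (v (2 ℕ.+ n)) (v (3 ℕ.+ n)) ⟩
  G (E v n - κ * v n) (E v (suc n) - κ * v (suc n)) (E v (2 ℕ.+ n) - κ * v (2 ℕ.+ n))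
    ≡⟨ cong₂ (λ (x , y) z → G x y z) (cong₂ _,_ (D-shift k m n) (D-shift k m (suc n))) (D-shift k m (2 ℕ.+ n)) ⟩
  G (E u n + κ * u n) (E u (suc n) + κ * u (suc n)) (E u (2 ℕ.+ n) + κ * u (2 ℕ.+ n))
    ≡⟨ solve 5 (λ κ u₀ u₁ u₂ u₃ →
         let y₀ = u₁ :+ u₂
             y₁ = u₂ :+ u₃
             c = κ :* (κ :+ con 1ℚ)
         in F κ ((u₀ :+ u₁) :+ κ :* u₀) ((u₁ :+ u₂) :+ κ :* u₁) ((u₂ :+ u₃) :+ κ :* u₂)
            := (c :* u₀ :- y₀) :+ (c :* u₁ :- y₁) :+ (con 1ℚ :+ κ) :* (c :* u₀ :- y₀))
         refl κ (u n) (u (suc n)) (u (2 ℕ.+ n)) (u (3 ℕ.+ n)) ⟩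
  (cκ * u n - Y u n) + (cκ * S u n - Y u (suc n)) + (1ℚ + κ) * (cκ * u n - Y u n) ∎
  where
  κ  = ℕ→ℚ k
  cκ = node k
  u  = D Y k m
  v  = D Y⁺ k m
  -- ((κ + 1)² − E²) applied to the sequence x, y, z, …
  G : ℚ → ℚ → ℚ → ℚ
  G x y z = κ * (κ + 1ℚ + 1ℚ) * x - (y + y) - z
  F : ∀ {n} → Polynomial n → Polynomial n → Polynomial n → Polynomial n → Polynomial n
  F κ x y z = κ :* (κ :+ con 1ℚ :+ con 1ℚ) :* x :- (y :+ y) :- z

-- A multiple of x² has derivative 0 at 0.
D-δ₁-vanish : ∀ k n → D Y k δ₁ (2 ℕ.+ n) ≡ 0ℚ
D-δ₁-vanish zero    n = refl
D-δ₁-vanish (suc k) n = begin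
  node k * d 0 - (d 1 + d 2)
    ≡⟨ cong₂ (λ x y → node k * x - y) (D-δ₁-vanish k n)
         (cong₂ _+_ (D-δ₁-vanish k (suc n)) (D-δ₁-vanish k (2 ℕ.+ n))) ⟩
  node k * 0ℚ - (0ℚ + 0ℚ)
    ≡⟨ solve 1 (λ c → c :* con 0ℚ :- (con 0ℚ :+ con 0ℚ) := con 0ℚ) refl (node k) ⟩
  0ℚ ∎
  where
  d : ℕ → ℚ
  d i = D Y k δ₁ (2 ℕ.+ (i ℕ.+ n))

-- The left side is f′(0) for f = (x - k) p_k. Passing to k + 1 multiplies f by (k + 1)² - x², and
-- the part with x² does not contribute.
D-δ₁ : ∀ k → D Y k δ₁ 1 - ℕ→ℚ k * D Y k δ₁ 0 ≡ ℕ→ℚ (k !) * ℕ→ℚ (k !)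
D-δ₁ zero    = refl
D-δ₁ (suc k) = begin
  (node k * b - (D Y k δ₁ 2 + D Y k δ₁ 3)) - ℕ→ℚ (suc k) * (node k * a - (b + D Y k δ₁ 2))
    ≡⟨ cong₂ (λ x y → (node k * b - (x + y)) - ℕ→ℚ (suc k) * (node k * a - (b + x)))
         (D-δ₁-vanish k 0) (D-δ₁-vanish k 1) ⟩
  (node k * b - (0ℚ + 0ℚ)) - ℕ→ℚ (suc k) * (node k * a - (b + 0ℚ))
    ≡⟨ cong (λ s → (node k * b - (0ℚ + 0ℚ)) - s * (node k * a - (b + 0ℚ))) (ℕ→ℚ-suc k) ⟩
  (node k * b - (0ℚ + 0ℚ)) - (1ℚ + κ) * (node k * a - (b + 0ℚ))
    ≡⟨ solve 3 (λ κ a b → let c = κ :* (κ :+ con 1ℚ) in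
           (c :* b :- (con 0ℚ :+ con 0ℚ)) :- (con 1ℚ :+ κ) :* (c :* a :- (b :+ con 0ℚ))
           := (con 1ℚ :+ κ) :* (con 1ℚ :+ κ) :* (b :- κ :* a)) refl κ a b ⟩
  (1ℚ + κ) * (1ℚ + κ) * (b - κ * a)
    ≡⟨ cong ((1ℚ + κ) * (1ℚ + κ) *_) (D-δ₁ k) ⟩
  (1ℚ + κ) * (1ℚ + κ) * (f * f)
    ≡⟨ solve 2 (λ s f → s :* s :* (f :* f) := s :* f :* (s :* f)) refl (1ℚ + κ) f ⟩
  (1ℚ + κ) * f * ((1ℚ + κ) * f)
    ≡⟨ cong₂ _*_ (ℕ→ℚ-suc! k) (ℕ→ℚ-suc! k) ⟨
  ℕ→ℚ (suc k !) * ℕ→ℚ (suc k !) ∎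
  where
  κ = ℕ→ℚ k
  f = ℕ→ℚ (k !)
  a = D Y k δ₁ 0
  b = D Y k δ₁ 1

-- Ψ(p_k), with p_k read as a polynomial in x.
μ : ℕ → ℚ
μ k = D Y k bernoulli 0

-- Apply Ψ(f(x + 1)) − Ψ(f(x)) = f′(0) to f = (x − k) p_k.
μ-closed : ∀ k → (ℕ→ℚ k + ℕ→ℚ k + 1ℚ) * μ k ≡ ℕ→ℚ (k !) * ℕ→ℚ (k !)
μ-closed k = begin
  (κ + κ + 1ℚ) * u 0
    ≡⟨ solve 3 (λ κ x y → (κ :+ κ :+ con 1ℚ) :* x := (x :+ y :+ κ :* x) :- y :+ κ :* x) refl κ (u 0) (u 1) ⟩
  E u 0 + κ * u 0 - u 1 + κ * u 0
    ≡⟨ cong (λ x → x - u 1 + κ * u 0) (D-shift k bernoulli 0) ⟨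
  E v 0 - κ * v 0 - u 1 + κ * u 0
    ≡⟨ cong₂ (λ x y → x - κ * y - u 1 + κ * u 0) (shifted 1) (shifted 0) ⟩
  (u 1 + d 1) - κ * (u 0 + d 0) - u 1 + κ * u 0
    ≡⟨ solve 5 (λ κ x y a b → (y :+ b) :- κ :* (x :+ a) :- y :+ κ :* x := b :- κ :* a) refl κ (u 0) (u 1) (d 0) (d 1) ⟩
  d 1 - κ * d 0
    ≡⟨ D-δ₁ k ⟩
  ℕ→ℚ (k !) * ℕ→ℚ (k !) ∎
  where
  κ = ℕ→ℚ k
  u = D Y k bernoulli
  v = D Y⁺ k bernoulli
  d = D Y k δ₁
  -- The shift rule for xⁿ p_k. Substituting x + 1 for x turns the factor x (x + 1) into (x + 1)(x +
  -- 2), hence `Y⁺` in `v`.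
  shifted : ∀ n → V E v n ≡ u n + d n
  shifted n = begin
    V E v n
      ≡⟨ D-intertwine Y-linear (V-linear E-linear) (λ m i → sym (+-homo (V-linear E-linear) (E m) (E (E m)) i)) k bernoulli n ⟨
    D Y k (V E bernoulli) n
      ≡⟨ ≗-cong (D-linear Y-linear k) V-E-bernoulli n ⟩
    D Y k (λ i → bernoulli i + δ₁ i) n
      ≡⟨ +-homo (D-linear Y-linear k) bernoulli δ₁ n ⟩
    u n + d n ∎

-- Racah polynomials

racahTerm : (α β γ δ : ℚ) → ℕ → ℕ → Poly
racahTerm α β γ δ n k = scaleP (racahCoeff α β γ δ n k) (racahBasis (γ + δ + 1ℚ) k)

racahSum : (α β γ δ : ℚ) → ℕ → ℕ → Poly
racahSum α β γ δ n zero    = []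
racahSum α β γ δ n (suc k) = addP (racahSum α β γ δ n k) (racahTerm α β γ δ n k)

mutual
  racah≡ : ∀ α β γ δ n → racah α β γ δ n ≡ racahSum α β γ δ n (suc n)
  racah≡ α β γ δ zero    = refl
  -- as a variable, addP is inert, so unification can descend into its arguments
  racah≡ α β γ δ (suc n) with addP
  ... | f = cong (λ p → f (f p (racahTerm α β γ δ (suc n) n)) (racahTerm α β γ δ (suc n) (suc n)))
      (racah-go-diag α β γ δ n)

  racah-go-diag : ∀ α β γ δ n → _ ≡ racahSum α β γ δ (suc n) n
  racah-go-diag α β γ δ n with suc n
  ... | N = racah-go≡ α β γ δ N n

  racah-go≡ : ∀ α β γ δ n k → _ ≡ racahSum α β γ δ n k
  racah-go≡ α β γ δ n zero    = refl
  racah-go≡ α β γ δ n (suc k) = cong (λ p → addP p (racahTerm α β γ δ n k)) (racah-go≡ α β γ δ n k)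

D-S-shift : ∀ k m → D S k (S m) 0 ≡ node k * D S k m 0 - D S (suc k) m 0
D-S-shift k m = trans (D-intertwine S-linear S-linear (λ _ _ → refl) k m 0)
  (solve 2 (λ x y → y := x :- (x :- y)) refl (node k * D S k m 0) (D S k m 1))

-- Here `m` is a sequence in the variable y, so multiplication by y is dual to `S`. The newest
-- factor acts on `m` first but comes last in `D S`; the two orders agree because polynomials in `S`
-- commute.
L-racahBasis : ∀ k m → L m (racahBasis 1ℚ k) ≡ D S k m 0
L-racahBasis zero    m = solve 1 (λ x → con 1ℚ :* x :+ con 0ℚ := x) refl (m 0)
L-racahBasis (suc k) m = begin
  L m (mulP (racahBasis 1ℚ k) (node k ∷ - 1ℚ ∷ []))
    ≡⟨ L-mulP m (racahBasis 1ℚ k) (node k ∷ - 1ℚ ∷ []) ⟩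
  L (λ n → node k * m (n ℕ.+ 0) + (- 1ℚ * m (n ℕ.+ 1) + 0ℚ)) (racahBasis 1ℚ k)
    ≡⟨ L-cong (λ n → trans
         (cong₂ (λ i j → node k * m i + (- 1ℚ * m j + 0ℚ)) (ℕ.+-identityʳ n) (ℕ.+-comm n 1))
         (solve 3 (λ c x y → c :* x :+ (con (- 1ℚ) :* y :+ con 0ℚ) := c :* x :- y) refl (node k) (m n) (m (suc n))))
         (racahBasis 1ℚ k) ⟩
  L (step S (node k) m) (racahBasis 1ℚ k)
    ≡⟨ L-racahBasis k (step S (node k) m) ⟩
  D S k (step S (node k) m) 0
    ≡⟨ D-intertwine S-linear (step-linear S-linear (node k)) (λ _ _ → refl) k m 0 ⟩
  D S (suc k) m 0 ∎

-- The factor 2ⁿ clears the denominators: twice the binomial is x (x + 1), whose powers `V Y`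
-- evaluates.
L-binom-pow : ∀ n m → ℕ→ℚ 2 ^ℚ n * L m (powP binomX+1-2 n) ≡ V Y m n
L-binom-pow zero    m = solve 1 (λ x → con 1ℚ :* (con 1ℚ :* x :+ con 0ℚ) := x) refl (m 0)
L-binom-pow (suc n) m = begin
  P * ℕ→ℚ 2 * L m (mulP (powP binomX+1-2 n) binomX+1-2)
    ≡⟨ cong (P * ℕ→ℚ 2 *_) (trans (L-mulP m (powP binomX+1-2 n) binomX+1-2) (L-cong half (powP binomX+1-2 n))) ⟩
  P * ℕ→ℚ 2 * L (λ i → ½ * Y m i) (powP binomX+1-2 n)
    ≡⟨ solve 2 (λ p l → p :* con (ℕ→ℚ 2) :* l := con (ℕ→ℚ 2) :* (p :* l)) refl P (L (λ i → ½ * Y m i) (powP binomX+1-2 n)) ⟩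
  ℕ→ℚ 2 * (P * L (λ i → ½ * Y m i) (powP binomX+1-2 n))
    ≡⟨ cong (ℕ→ℚ 2 *_) (L-binom-pow n (λ i → ½ * Y m i)) ⟩
  ℕ→ℚ 2 * V Y (λ i → ½ * Y m i) n
    ≡⟨ cong (ℕ→ℚ 2 *_) (*-homo (V-linear Y-linear) ½ (Y m) n) ⟩
  ℕ→ℚ 2 * (½ * V Y (Y m) n)
    ≡⟨ solve 1 (λ x → con (ℕ→ℚ 2) :* (con ½ :* x) := x) refl (V Y (Y m) n) ⟩
  V Y m (suc n) ∎
  where
  P = ℕ→ℚ 2 ^ℚ n
  half : ∀ i → L (λ j → m (i ℕ.+ j)) binomX+1-2 ≡ ½ * Y m i
  half i = trans
    (cong₂ (λ x y → 0ℚ * m (i ℕ.+ 0) + (½ * m x + (½ * m y + 0ℚ))) (ℕ.+-comm i 1) (ℕ.+-comm i 2))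
    (solve 3 (λ x y z → con 0ℚ :* x :+ (con ½ :* y :+ (con ½ :* z :+ con 0ℚ)) := con ½ :* (y :+ z)) refl
      (m (i ℕ.+ 0)) (m (suc i)) (m (2 ℕ.+ i)))

-- The claimed moments on the basis p_k

claimedMoment≡ : ∀ n → claimedMoment n ≡ - ℕ→ℚ 3 * S (V Y bernoulli) n
claimedMoment≡ n = begin
  -- `ℛ⁻ 1` evaluates to -1/6, so dividing by it computes to multiplying by -6. One factor 2 then
  -- goes into the power, leaving -3.
  P * ℛ⁻ (suc n) * - ℕ→ℚ 6
    ≡⟨ solve 2 (λ p r → p :* r :* con (- ℕ→ℚ 6) := con (- ℕ→ℚ 3) :* (p :* con (ℕ→ℚ 2) :* r)) refl P (ℛ⁻ (suc n)) ⟩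
  - ℕ→ℚ 3 * (P * ℕ→ℚ 2 * ℛ⁻ (suc n))
    ≡⟨ cong (λ r → - ℕ→ℚ 3 * (P * ℕ→ℚ 2 * r)) (applyLF≡L bernoulli (powP binomX+1-2 (suc n))) ⟩
  - ℕ→ℚ 3 * (P * ℕ→ℚ 2 * L bernoulli (powP binomX+1-2 (suc n)))
    ≡⟨ cong (- ℕ→ℚ 3 *_) (L-binom-pow (suc n) bernoulli) ⟩
  - ℕ→ℚ 3 * V Y bernoulli (suc n) ∎
  where
  P = ℕ→ℚ 2 ^ℚ n

-- Λ(p_k), with p_k read as a polynomial in y.
basisMoment : ℕ → ℚ
basisMoment k = D S k claimedMoment 0

basisMoment≡μ : ∀ k → basisMoment k ≡ - ℕ→ℚ 3 * (node k * μ k - μ (suc k))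
basisMoment≡μ k = begin
  D S k claimedMoment 0
    ≡⟨ ≗-cong (D-linear S-linear k) claimedMoment≡ 0 ⟩
  D S k (λ n → - ℕ→ℚ 3 * S W n) 0
    ≡⟨ *-homo (D-linear S-linear k) (- ℕ→ℚ 3) (S W) 0 ⟩
  - ℕ→ℚ 3 * D S k (S W) 0
    ≡⟨ cong (- ℕ→ℚ 3 *_) (D-S-shift k W) ⟩
  - ℕ→ℚ 3 * (node k * D S k W 0 - D S (suc k) W 0)
    ≡⟨ cong₂ (λ x y → - ℕ→ℚ 3 * (node k * x - y)) (at k) (at (suc k)) ⟩
  - ℕ→ℚ 3 * (node k * μ k - μ (suc k)) ∎
  where
  W = V Y bernoulli
  -- Substituting x (x + 1) for y turns `S` into `Y`, by the definition of `V`.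
  at : ∀ k → D S k W 0 ≡ μ k
  at k = D-intertwine S-linear (V-linear Y-linear) (λ _ _ → refl) k bernoulli 0

-- Over a common denominator the numerator collapses, since k (2k + 3) - (2k + 1)(k + 1) = -1.
basisMoment-closed : ∀ k → let κ = ℕ→ℚ k; f = ℕ→ℚ (k !) in
  (κ + κ + 1ℚ) * (κ + κ + ℕ→ℚ 3) * basisMoment k ≡ ℕ→ℚ 3 * (1ℚ + κ) * (f * f)
basisMoment-closed k = begin
  (κ + κ + 1ℚ) * (κ + κ + ℕ→ℚ 3) * basisMoment k
    ≡⟨ cong ((κ + κ + 1ℚ) * (κ + κ + ℕ→ℚ 3) *_) (basisMoment≡μ k) ⟩
  (κ + κ + 1ℚ) * (κ + κ + ℕ→ℚ 3) * (- ℕ→ℚ 3 * (node k * μ k - μ (suc k)))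
    ≡⟨ solve 3 (λ κ x y → (κ :+ κ :+ con 1ℚ) :* (κ :+ κ :+ con (ℕ→ℚ 3)) :* (con (- ℕ→ℚ 3) :* (κ :* (κ :+ con 1ℚ) :* x :- y))
         := con (- ℕ→ℚ 3) :* (κ :* (κ :+ con 1ℚ) :* (κ :+ κ :+ con (ℕ→ℚ 3)) :* ((κ :+ κ :+ con 1ℚ) :* x)
              :- (κ :+ κ :+ con 1ℚ) :* (((con 1ℚ :+ κ) :+ (con 1ℚ :+ κ) :+ con 1ℚ) :* y))) refl κ (μ k) (μ (suc k)) ⟩
  - ℕ→ℚ 3 * (node k * (κ + κ + ℕ→ℚ 3) * ((κ + κ + 1ℚ) * μ k)
    - (κ + κ + 1ℚ) * (((1ℚ + κ) + (1ℚ + κ) + 1ℚ) * μ (suc k)))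
    ≡⟨ cong₂ (λ x y → - ℕ→ℚ 3 * (node k * (κ + κ + ℕ→ℚ 3) * x - (κ + κ + 1ℚ) * y)) (μ-closed k) μ′ ⟩
  - ℕ→ℚ 3 * (node k * (κ + κ + ℕ→ℚ 3) * (f * f) - (κ + κ + 1ℚ) * ((1ℚ + κ) * f * ((1ℚ + κ) * f)))
    ≡⟨ solve 2 (λ κ f → con (- ℕ→ℚ 3) :* (κ :* (κ :+ con 1ℚ) :* (κ :+ κ :+ con (ℕ→ℚ 3)) :* (f :* f)
              :- (κ :+ κ :+ con 1ℚ) :* ((con 1ℚ :+ κ) :* f :* ((con 1ℚ :+ κ) :* f)))
         := con (ℕ→ℚ 3) :* (con 1ℚ :+ κ) :* (f :* f)) refl κ f ⟩
  ℕ→ℚ 3 * (1ℚ + κ) * (f * f) ∎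
  where
  κ = ℕ→ℚ k
  f = ℕ→ℚ (k !)
  μ′ : ((1ℚ + κ) + (1ℚ + κ) + 1ℚ) * μ (suc k) ≡ (1ℚ + κ) * f * ((1ℚ + κ) * f)
  μ′ = subst₂ (λ x y → (x + x + 1ℚ) * μ (suc k) ≡ y * y) (ℕ→ℚ-suc k) (ℕ→ℚ-suc! k) (μ-closed (suc k))

-- The ratio of consecutive values, in the form needed for a hypergeometric term ratio. The factor
-- 2k + 3 occurs in the closed forms at k and at k + 1 and cancels.
basisMoment-suc : ∀ k → let κ = ℕ→ℚ k in
  (κ + κ + ℕ→ℚ 5) * basisMoment (suc k) ≡ (κ + κ + 1ℚ) * (1ℚ + κ) * (κ + ℕ→ℚ 2) * basisMoment k
basisMoment-suc k = *-cancelʳ-≢0 (κ + κ + ℕ→ℚ 3) 2κ+3≢0 (begin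
  (κ + κ + ℕ→ℚ 5) * e′ * (κ + κ + ℕ→ℚ 3)
    ≡⟨ solve 2 (λ κ e → (κ :+ κ :+ con (ℕ→ℚ 5)) :* e :* (κ :+ κ :+ con (ℕ→ℚ 3))
         := ((con 1ℚ :+ κ) :+ (con 1ℚ :+ κ) :+ con 1ℚ) :* ((con 1ℚ :+ κ) :+ (con 1ℚ :+ κ) :+ con (ℕ→ℚ 3)) :* e) refl κ e′ ⟩
  ((1ℚ + κ) + (1ℚ + κ) + 1ℚ) * ((1ℚ + κ) + (1ℚ + κ) + ℕ→ℚ 3) * e′
    ≡⟨ subst₂ (λ x y → (x + x + 1ℚ) * (x + x + ℕ→ℚ 3) * e′ ≡ ℕ→ℚ 3 * (1ℚ + x) * (y * y))
         (ℕ→ℚ-suc k) (ℕ→ℚ-suc! k) (basisMoment-closed (suc k)) ⟩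
  ℕ→ℚ 3 * (1ℚ + (1ℚ + κ)) * ((1ℚ + κ) * f * ((1ℚ + κ) * f))
    ≡⟨ solve 2 (λ κ f → con (ℕ→ℚ 3) :* (con 1ℚ :+ (con 1ℚ :+ κ)) :* ((con 1ℚ :+ κ) :* f :* ((con 1ℚ :+ κ) :* f))
         := (con 1ℚ :+ κ) :* (κ :+ con (ℕ→ℚ 2)) :* (con (ℕ→ℚ 3) :* (con 1ℚ :+ κ) :* (f :* f))) refl κ f ⟩
  (1ℚ + κ) * (κ + ℕ→ℚ 2) * (ℕ→ℚ 3 * (1ℚ + κ) * (f * f))
    ≡⟨ cong ((1ℚ + κ) * (κ + ℕ→ℚ 2) *_) (basisMoment-closed k) ⟨
  (1ℚ + κ) * (κ + ℕ→ℚ 2) * ((κ + κ + 1ℚ) * (κ + κ + ℕ→ℚ 3) * e)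
    ≡⟨ solve 2 (λ κ e → (con 1ℚ :+ κ) :* (κ :+ con (ℕ→ℚ 2)) :* ((κ :+ κ :+ con 1ℚ) :* (κ :+ κ :+ con (ℕ→ℚ 3)) :* e)
         := (κ :+ κ :+ con 1ℚ) :* (con 1ℚ :+ κ) :* (κ :+ con (ℕ→ℚ 2)) :* e :* (κ :+ κ :+ con (ℕ→ℚ 3))) refl κ e ⟩
  (κ + κ + 1ℚ) * (1ℚ + κ) * (κ + ℕ→ℚ 2) * e * (κ + κ + ℕ→ℚ 3) ∎)
  where
  κ = ℕ→ℚ k
  f = ℕ→ℚ (k !)
  e = basisMoment k
  e′ = basisMoment (suc k)
  2κ+3≢0 : κ + κ + ℕ→ℚ 3 ≢ 0ℚ
  2κ+3≢0 eq = pos⇒≢0 (ℕ→ℚ 3 + ℕ→ℚ (k ℕ.+ k)) (pos+ℕ→ℚ (ℕ→ℚ 3) (k ℕ.+ k))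
    (trans (+-comm (ℕ→ℚ 3) (ℕ→ℚ (k ℕ.+ k))) (trans (cong (_+ ℕ→ℚ 3) (ℕ→ℚ-homo-+ k k)) eq))

-- Hypergeometric coefficients

poch-≢0 : ∀ a k → (∀ j → j ℕ.< k → a + ℕ→ℚ j ≢ 0ℚ) → poch a k ≢ 0ℚ
poch-≢0 a zero    _     = λ ()
poch-≢0 a (suc k) a+j≢0 = *-≢0 (poch-≢0 a k (λ j j<k → a+j≢0 j (ℕ.m<n⇒m<1+n j<k))) (a+j≢0 k (ℕ.n<1+n k))

poch-pos-≢0 : ∀ a .{{_ : Positive a}} k → poch a k ≢ 0ℚ
poch-pos-≢0 a k = poch-≢0 a k (λ j _ → pos⇒≢0 _ (pos+ℕ→ℚ a j))

-- n + 3/2, in the form in which it occurs in racahCoeff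
upper : ℕ → ℚ
upper n = ℕ→ℚ n + - ½ + 1ℚ + 1ℚ

upper+j≢0 : ∀ n j → upper n + ℕ→ℚ j ≢ 0ℚ
upper+j≢0 n j eq = pos⇒≢0 (3/2 + ℕ→ℚ (n ℕ.+ j)) (pos+ℕ→ℚ 3/2 (n ℕ.+ j)) (begin
  3/2 + ℕ→ℚ (n ℕ.+ j)       ≡⟨ cong (3/2 +_) (ℕ→ℚ-homo-+ n j) ⟩
  3/2 + (ℕ→ℚ n + ℕ→ℚ j)     ≡⟨ solve 2 (λ x y → con 3/2 :+ (x :+ y) := x :+ con (- ½) :+ con 1ℚ :+ con 1ℚ :+ y) refl (ℕ→ℚ n) (ℕ→ℚ j) ⟩
  upper n + ℕ→ℚ j           ≡⟨ eq ⟩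
  0ℚ                        ∎)
  where 3/2 = 1ℚ + ½

-n+j≢0 : ∀ {n j} → j ℕ.< n → - ℕ→ℚ n + ℕ→ℚ j ≢ 0ℚ
-n+j≢0 {n} {j} j<n eq with ℕ.m≤n⇒∃[o]m+o≡n j<n
... | o , refl = pos⇒≢0 (ℕ→ℚ (suc o)) (ℕ→ℚ-pos (suc o)) (begin
  ℕ→ℚ (suc o)
    ≡⟨ solve 2 (λ j s → s := :- (:- (j :+ s) :+ j)) refl (ℕ→ℚ j) (ℕ→ℚ (suc o)) ⟩
  - (- (ℕ→ℚ j + ℕ→ℚ (suc o)) + ℕ→ℚ j)
    ≡⟨ cong (λ x → - (- x + ℕ→ℚ j)) (trans (sym (ℕ→ℚ-homo-+ j (suc o))) (cong ℕ→ℚ (ℕ.+-suc j o))) ⟩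
  - (- ℕ→ℚ (suc (j ℕ.+ o)) + ℕ→ℚ j)
    ≡⟨ cong -_ eq ⟩
  0ℚ ∎)

coeff numerator : ℕ → ℕ → ℚ
coeff = racahCoeff (- ½) 1ℚ 0ℚ 0ℚ
numerator n k = poch (- ℕ→ℚ n) k * poch (upper n) k

-- The bases ½, 2 and 1 are α + 1, β + δ + 1 and γ + 1.
denominator : ℕ → ℚ
denominator k = poch ½ k * poch (ℕ→ℚ 2) k * poch 1ℚ k * ℕ→ℚ (k !)

denominator≢0 : ∀ k → denominator k ≢ 0ℚ
denominator≢0 k = *-≢0 (*-≢0 (*-≢0 (poch-pos-≢0 ½ k) (poch-pos-≢0 (ℕ→ℚ 2) k)) (poch-pos-≢0 1ℚ k)) (n!≢0 k)

coeff-cancel : ∀ n k → coeff n k * denominator k ≡ numerator n k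
coeff-cancel n k = ÷′-*-cancel (numerator n k) (denominator≢0 k)

coeff-suc : ∀ n k → let κ = ℕ→ℚ k in
  coeff n (suc k) * ((½ + κ) * (ℕ→ℚ 2 + κ) * (1ℚ + κ) * (1ℚ + κ))
    ≡ coeff n k * ((- ℕ→ℚ n + κ) * (upper n + κ))
coeff-suc n k = *-cancelʳ-≢0 (denominator k) (denominator≢0 k) (begin
  q′ * ((½ + κ) * (ℕ→ℚ 2 + κ) * (1ℚ + κ) * (1ℚ + κ)) * (p₁ * p₂ * p₃ * f)
    ≡⟨ solve 9 (λ q a b c d p₁ p₂ p₃ f → q :* (a :* b :* c :* d) :* (p₁ :* p₂ :* p₃ :* f)
         := q :* ((p₁ :* a) :* (p₂ :* b) :* (p₃ :* c) :* (d :* f))) refl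
         q′ (½ + κ) (ℕ→ℚ 2 + κ) (1ℚ + κ) (1ℚ + κ) p₁ p₂ p₃ f ⟩
  q′ * (p₁ * (½ + κ) * (p₂ * (ℕ→ℚ 2 + κ)) * (p₃ * (1ℚ + κ)) * ((1ℚ + κ) * f))
    ≡⟨ cong (λ g → q′ * (p₁ * (½ + κ) * (p₂ * (ℕ→ℚ 2 + κ)) * (p₃ * (1ℚ + κ)) * g)) (ℕ→ℚ-suc! k) ⟨
  q′ * denominator (suc k)
    ≡⟨ coeff-cancel n (suc k) ⟩
  numerator n (suc k)
    ≡⟨ solve 4 (λ x y a b → (x :* a) :* (y :* b) := (x :* y) :* (a :* b)) refl
         (poch (- ℕ→ℚ n) k) (poch (upper n) k) (- ℕ→ℚ n + κ) (upper n + κ) ⟩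
  numerator n k * ((- ℕ→ℚ n + κ) * (upper n + κ))
    ≡⟨ cong (_* ((- ℕ→ℚ n + κ) * (upper n + κ))) (coeff-cancel n k) ⟨
  q * denominator k * ((- ℕ→ℚ n + κ) * (upper n + κ))
    ≡⟨ solve 3 (λ q d r → q :* d :* r := q :* r :* d) refl q (denominator k) ((- ℕ→ℚ n + κ) * (upper n + κ)) ⟩
  q * ((- ℕ→ℚ n + κ) * (upper n + κ)) * denominator k ∎)
  where
  κ = ℕ→ℚ k
  f = ℕ→ℚ (k !)
  p₁ = poch ½ k
  p₂ = poch (ℕ→ℚ 2) k
  p₃ = poch 1ℚ k
  q = coeff n k
  q′ = coeff n (suc k)

-- The factors of (-n)_n are -n + j with j < n, so none vanishes. Expanding R_n in the p_k is
-- therefore an invertible triangular system.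
coeff-diag-≢0 : ∀ n → coeff n n ≢ 0ℚ
coeff-diag-≢0 n eq = *-≢0
  (poch-≢0 (- ℕ→ℚ n) n (λ j j<n → -n+j≢0 j<n))
  (poch-≢0 (upper n) n (λ j _ → upper+j≢0 n j))
  (trans (sym (coeff-cancel n n)) (trans (cong (_* denominator n) eq) (*-zeroˡ (denominator n))))

L-racahSum : ∀ m n k → L m (racahSum (- ½) 1ℚ 0ℚ 0ℚ n k) ≡ Σ< k (λ j → coeff n j * D S j m 0)
L-racahSum m n zero    = refl
L-racahSum m n (suc k) = begin
  L m (addP (racahSum (- ½) 1ℚ 0ℚ 0ℚ n k) (racahTerm (- ½) 1ℚ 0ℚ 0ℚ n k))
    ≡⟨ L-addP m (racahSum (- ½) 1ℚ 0ℚ 0ℚ n k) _ ⟩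
  L m (racahSum (- ½) 1ℚ 0ℚ 0ℚ n k) + L m (scaleP (coeff n k) (racahBasis 1ℚ k))
    ≡⟨ cong₂ _+_ (L-racahSum m n k) (trans (L-scaleP m (coeff n k) (racahBasis 1ℚ k)) (cong (coeff n k *_) (L-racahBasis k m))) ⟩
  Σ< (suc k) (λ j → coeff n j * D S j m 0) ∎

applyLF-R : ∀ m n → applyLF m (R n) ≡ Σ< (suc n) (λ j → coeff n j * D S j m 0)
applyLF-R m n = trans (applyLF≡L m (R n)) (trans (cong (L m) (racah≡ (- ½) 1ℚ 0ℚ 0ℚ n)) (L-racahSum m n (suc n)))

-- Vanishing of the claimed form on R_n

term : ℕ → ℕ → ℚ
term n k = coeff n k * basisMoment k

-- The ratio of the values Λ(p_k) cancels ½ + k, 2 + k and one factor 1 + k of the coefficient ratio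
-- and contributes k + 5/2, which leaves the term ratio of ₂F₁(-n, n + 3/2; 5/2; 1).
term-suc : ∀ n k → let κ = ℕ→ℚ k in
  (1ℚ + κ) * (κ + ½ + ℕ→ℚ 2) * term n (suc k) ≡ (- ℕ→ℚ n + κ) * (upper n + κ) * term n k
term-suc n k = begin
  (1ℚ + κ) * (κ + ½ + ℕ→ℚ 2) * (q′ * e′)
    ≡⟨ solve 3 (λ κ q e → (con 1ℚ :+ κ) :* (κ :+ con ½ :+ con (ℕ→ℚ 2)) :* (q :* e)
         := con ½ :* (con 1ℚ :+ κ) :* q :* ((κ :+ κ :+ con (ℕ→ℚ 5)) :* e)) refl κ q′ e′ ⟩
  ½ * (1ℚ + κ) * q′ * ((κ + κ + ℕ→ℚ 5) * e′)
    ≡⟨ cong (½ * (1ℚ + κ) * q′ *_) (basisMoment-suc k) ⟩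
  ½ * (1ℚ + κ) * q′ * ((κ + κ + 1ℚ) * (1ℚ + κ) * (κ + ℕ→ℚ 2) * e)
    ≡⟨ solve 3 (λ κ q e → con ½ :* (con 1ℚ :+ κ) :* q :* ((κ :+ κ :+ con 1ℚ) :* (con 1ℚ :+ κ) :* (κ :+ con (ℕ→ℚ 2)) :* e)
         := q :* ((con ½ :+ κ) :* (con (ℕ→ℚ 2) :+ κ) :* (con 1ℚ :+ κ) :* (con 1ℚ :+ κ)) :* e) refl κ q′ e ⟩
  q′ * ((½ + κ) * (ℕ→ℚ 2 + κ) * (1ℚ + κ) * (1ℚ + κ)) * e
    ≡⟨ cong (_* e) (coeff-suc n k) ⟩
  q * ((- ℕ→ℚ n + κ) * (upper n + κ)) * e
    ≡⟨ solve 4 (λ q x y e → q :* (x :* y) :* e := x :* y :* (q :* e)) refl q (- ℕ→ℚ n + κ) (upper n + κ) e ⟩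
  (- ℕ→ℚ n + κ) * (upper n + κ) * (q * e) ∎
  where
  κ = ℕ→ℚ k
  q = coeff n k
  q′ = coeff n (suc k)
  e = basisMoment k
  e′ = basisMoment (suc k)

-- ₂F₁(a, b; a + b + 1; 1) is summable in closed form, here with a = −n and b = n + 3/2.
term-sum : ∀ n k →
  - ℕ→ℚ n * upper n * Σ< (suc k) (term n) ≡ (- ℕ→ℚ n + ℕ→ℚ k) * (upper n + ℕ→ℚ k) * term n k
term-sum n zero = solve 3 (λ a b t → a :* b :* (con 0ℚ :+ t) := (a :+ con 0ℚ) :* (b :+ con 0ℚ) :* t) refl
  (- ℕ→ℚ n) (upper n) (term n 0)
term-sum n (suc k) = begin
  a * b * (Σ< (suc k) (term n) + t′)
    ≡⟨ *-distribˡ-+ (a * b) (Σ< (suc k) (term n)) t′ ⟩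
  a * b * Σ< (suc k) (term n) + a * b * t′
    ≡⟨ cong (_+ a * b * t′) (trans (term-sum n k) (sym (term-suc n k))) ⟩
  (1ℚ + κ) * (κ + ½ + ℕ→ℚ 2) * t′ + a * b * t′
    -- Since a + b = 3/2, (1 + κ)(κ + 5/2) + a b factors as (a + 1 + κ)(b + 1 + κ).
    ≡⟨ solve 3 (λ ν κ t → let b = ν :+ con (- ½) :+ con 1ℚ :+ con 1ℚ in
         (con 1ℚ :+ κ) :* (κ :+ con ½ :+ con (ℕ→ℚ 2)) :* t :+ (:- ν) :* b :* t
         := (:- ν :+ (con 1ℚ :+ κ)) :* (b :+ (con 1ℚ :+ κ)) :* t) refl (ℕ→ℚ n) κ t′ ⟩
  (a + (1ℚ + κ)) * (b + (1ℚ + κ)) * t′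
    ≡⟨ cong (λ x → (a + x) * (b + x) * t′) (ℕ→ℚ-suc k) ⟨
  (a + ℕ→ℚ (suc k)) * (b + ℕ→ℚ (suc k)) * t′ ∎
  where
  a = - ℕ→ℚ n
  b = upper n
  κ = ℕ→ℚ k
  t′ = term n (suc k)

claimed-R0 : applyLF claimedMoment (R 0) ≡ 1ℚ
claimed-R0 = refl

claimed-R : ∀ n → applyLF claimedMoment (R (suc n)) ≡ 0ℚ
claimed-R n = *-cancelʳ-≢0 (a * b) (*-≢0 a≢0 b≢0) (begin
  applyLF claimedMoment (R N) * (a * b)
    ≡⟨ cong (_* (a * b)) (applyLF-R claimedMoment N) ⟩
  Σ< (suc N) (term N) * (a * b)
    ≡⟨ *-comm (Σ< (suc N) (term N)) (a * b) ⟩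
  a * b * Σ< (suc N) (term N)
    -- The full sum ends at index N, where the closed form contains the factor -N + N.
    ≡⟨ term-sum N N ⟩
  (a + ℕ→ℚ N) * (b + ℕ→ℚ N) * term N N
    ≡⟨ solve 3 (λ ν b t → (:- ν :+ ν) :* b :* t := con 0ℚ) refl (ℕ→ℚ N) (b + ℕ→ℚ N) (term N N) ⟩
  0ℚ
    ≡⟨ *-zeroˡ (a * b) ⟨
  0ℚ * (a * b) ∎)
  where
  N = suc n
  a = - ℕ→ℚ N
  b = upper N
  a≢0 : a ≢ 0ℚ
  a≢0 eq = -n+j≢0 {N} {0} ℕ.z<s (trans (+-identityʳ a) eq)
  b≢0 : b ≢ 0ℚ
  b≢0 eq = upper+j≢0 N 0 (trans (+-identityʳ b) eq)

-- Uniqueness of the form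

Σ<-cong : ∀ n {f g} → (∀ j → j ℕ.< n → f j ≡ g j) → Σ< n f ≡ Σ< n g
Σ<-cong zero    f≡g = refl
Σ<-cong (suc n) f≡g = cong₂ _+_ (Σ<-cong n (λ j j<n → f≡g j (ℕ.m<n⇒m<1+n j<n))) (f≡g n (ℕ.n<1+n n))

-- Forward substitution in the triangular system: by strong induction the terms of R_k below p_k
-- agree, and the nonzero diagonal coefficient is then cancelled.
R-determines-basis : ∀ m m′ → (∀ n → applyLF m (R n) ≡ applyLF m′ (R n)) → ∀ k → D S k m 0 ≡ D S k m′ 0
R-determines-basis m m′ eq = ℕ.<-rec _ λ k ih →
  *-cancelʳ-≢0 (coeff k k) (coeff-diag-≢0 k)
    (trans (*-comm (D S k m 0) (coeff k k))
      (trans (+-cancelˡ (s m k) _ _ (begin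
          s m k + coeff k k * D S k m 0    ≡⟨ applyLF-R m k ⟨
          applyLF m (R k)                  ≡⟨ eq k ⟩
          applyLF m′ (R k)                 ≡⟨ applyLF-R m′ k ⟩
          s m′ k + coeff k k * D S k m′ 0  ≡⟨ cong (_+ coeff k k * D S k m′ 0) (Σ<-cong k λ j j<k → cong (coeff k j *_) (ih j<k)) ⟨
          s m k + coeff k k * D S k m′ 0   ∎))
        (*-comm (coeff k k) (D S k m′ 0))))
  where
  s : (ℕ → ℚ) → ℕ → ℚ
  s m k = Σ< k (λ j → coeff k j * D S j m 0)

-- y p_k = k (k + 1) p_k − p_{k+1}, so the values on the p_k also determine f ↦ Λ(y f).
basis-determines : ∀ m m′ → (∀ k → D S k m 0 ≡ D S k m′ 0) → m ≗ m′
basis-determines m m′ eq zero    = eq 0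
basis-determines m m′ eq (suc n) = basis-determines (S m) (S m′) (λ k → begin
  D S k (S m) 0                            ≡⟨ D-S-shift k m ⟩
  node k * D S k m 0 - D S (suc k) m 0     ≡⟨ cong₂ (λ x y → node k * x - y) (eq k) (eq (suc k)) ⟩
  node k * D S k m′ 0 - D S (suc k) m′ 0   ≡⟨ D-S-shift k m′ ⟨
  D S k (S m′) 0                           ∎) n

theorem2p2 : (m : ℕ → ℚ) →
    ((applyLF m (R 0) ≡ 1ℚ) × (∀ n → applyLF m (R (suc n)) ≡ 0ℚ))
    ⇔ (∀ n → m n ≡ claimedMoment n)
theorem2p2 m = mk⇔
  (λ (R₀ , Rₙ) → basis-determines m claimedMoment (R-determines-basis m claimedMoment λ where
    zero    → trans R₀ (sym claimed-R0)
    (suc n) → trans (Rₙ n) (sym (claimed-R n))))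
  (λ m≡ → trans (transfer m≡ 0) claimed-R0 , λ n → trans (transfer m≡ (suc n)) (claimed-R n))
  where
  transfer : m ≗ claimedMoment → ∀ n → applyLF m (R n) ≡ applyLF claimedMoment (R n)
  transfer m≡ n = trans (applyLF≡L m (R n)) (trans (L-cong m≡ (R n)) (sym (applyLF≡L claimedMoment (R n))))
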